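{- Every solid branchwise implicative weak BCC-algebra is branchwise commutative.
   Context: A weak BCC-algebra is a set $X$ with a binary operation $*$ and a constant $0$ satisfying, for all $x,y,z\in X$: (i) $((x*y)*(z*y))*(x*z)=0$; (ii) $x*x=0$; (iii) $x*0=x$; (iv) $x*y=y*x=0$ implies $x=y$. The relation $x\leqslant y$ iff $x*y=0$ is a partial order on $X$. Let $I(X)$ be the set of minimal elements of $X$ with respect to $\leqslant$. For $a\in I(X)$ the branch initiated by $a$ is $B(a)=\{x\in X: a\leqslant x\}$; "belonging to the same branch" means lying in a common $B(a)$. A weak BCC-algebra is called (left) solid if $(x*y)*z=(x*z)*y$ holds for all $x,y$ belonging to the same branch and all $z\in X$. It is branchwise implicative if $x*(y*x)=x$ for all $x,y$ belonging to the same branch, and branchwise commutative if $x*(x*y)=y*(y*x)$ for all $x,y$ belonging to the same branch. -}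

module Defs where

open import Algebra.Core using (Op₂)
open import Algebra.Structures using (IsMagma)
open import Data.Product using (_×_; ∃-syntax)
open import Level using (Level; _⊔_; suc)
open import Relation.Binary.Core using (Rel)
open import Relation.Unary using (Pred; _∈_)

-- As for the library's algebraic bundles, the underlying set is a setoid:
-- equality in the axioms is _≈_, and isMagma says that _≈_ is an
-- equivalence relation respected by _*_.
record WeakBCCAlgebra (c ℓ : Level) : Set (suc (c ⊔ ℓ)) where
  infixl 7 _*_
  infix  4 _≈_ _≤_
  field
    Carrier     : Set c
    _≈_         : Rel Carrier ℓ
    _*_         : Op₂ Carrier
    0#          : Carrier
    isMagma     : IsMagma _≈_ _*_
    bcc         : ∀ x y z → ((x * y) * (z * y)) * (x * z) ≈ 0#
    *-self      : ∀ x → x * x ≈ 0#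
    *-identityʳ : ∀ x → x * 0# ≈ x
    *-antisym   : ∀ {x y} → x * y ≈ 0# → y * x ≈ 0# → x ≈ y

  open IsMagma isMagma public

  _≤_ : Rel Carrier ℓ
  x ≤ y = x * y ≈ 0#

  -- I is the set of minimal (not necessarily least) elements.
  I : Pred Carrier (c ⊔ ℓ)
  I a = ∀ x → x ≤ a → x ≈ a

  -- B a is a branch only when a ∈ I.
  B : Carrier → Pred Carrier ℓ
  B a x = a ≤ x

  SameBranch : Rel Carrier (c ⊔ ℓ)
  SameBranch x y = ∃[ a ] (a ∈ I × x ∈ B a × y ∈ B a)

  -- The element z is not required to lie in the branch of x and y.
  Solid : Set (c ⊔ ℓ)
  Solid = ∀ x y z → SameBranch x y → (x * y) * z ≈ (x * z) * y

  BranchwiseImplicative : Set (c ⊔ ℓ)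
  BranchwiseImplicative = ∀ x y → SameBranch x y → x * (y * x) ≈ x

  BranchwiseCommutative : Set (c ⊔ ℓ)
  BranchwiseCommutative = ∀ x y → SameBranch x y → x * (x * y) ≈ y * (y * x)

{-# OPTIONS --safe #-}

-- Let a be a minimal element below x and y, and put u = x * (x * y).  Then
-- u is a lower bound of x and y and lies in B a.  Implicativity of u and y
-- gives u ≈ u * (y * u) ≤ y * (y * u) ≤ y * (y * x), and by symmetry of x
-- and y the two sides of the commutativity law are equal.
module Submission where

open import Defs
open import Level using (Level)
open import Data.Product using (_,_)
open import Relation.Unary using (_∈_)

module WeakBCCProperties {c ℓ : Level} (X : WeakBCCAlgebra c ℓ) where
  open WeakBCCAlgebra X

  ≤-respˡ-≈ : ∀ {x y z} → x ≈ y → x ≤ z → y ≤ z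
  ≤-respˡ-≈ x≈y x≤z = trans (∙-congʳ (sym x≈y)) x≤z

  ≤-respʳ-≈ : ∀ {x y z} → y ≈ z → x ≤ y → x ≤ z
  ≤-respʳ-≈ y≈z x≤y = trans (∙-congˡ (sym y≈z)) x≤y

  x≤0⇒x≈0 : ∀ {x} → x ≤ 0# → x ≈ 0#
  x≤0⇒x≈0 {x} x≤0 = trans (sym (*-identityʳ x)) x≤0

  -- In `bcc x z y` the factor `x * y` vanishes; for `*-antiʳ-≤` below it is `y * z` that vanishes.
  *-monoˡ-≤ : ∀ z {x y} → x ≤ y → x * z ≤ y * z
  *-monoˡ-≤ z {x} {y} x≤y = x≤0⇒x≈0 (≤-respʳ-≈ x≤y (bcc x z y))

  *-antiʳ-≤ : ∀ x {y z} → y ≤ z → x * z ≤ x * y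
  *-antiʳ-≤ x {y} {z} y≤z =
    ≤-respˡ-≈ (trans (∙-congˡ y≤z) (*-identityʳ (x * z))) (bcc x z y)

  ≤-trans : ∀ {x y z} → x ≤ y → y ≤ z → x ≤ z
  ≤-trans {x} x≤y y≤z = x≤0⇒x≈0 (≤-respʳ-≈ x≤y (*-antiʳ-≤ x y≤z))

  sameBranch-sym : ∀ {x y} → SameBranch x y → SameBranch y x
  sameBranch-sym (a , a∈I , a≤x , a≤y) = a , a∈I , a≤y , a≤x

  -- Multiply `a ≤ x` on the right by `y`: the left side `a * y` is `0#`.
  sameBranch⇒0≤x*y : ∀ {x y} → SameBranch x y → 0# ≤ x * y
  sameBranch⇒0≤x*y {y = y} (_ , _ , a≤x , a≤y) = ≤-respˡ-≈ a≤y (*-monoˡ-≤ y a≤x)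

  0≤y⇒x*y≤x : ∀ x {y} → 0# ≤ y → x * y ≤ x
  0≤y⇒x*y≤x x 0≤y = ≤-respʳ-≈ (*-identityʳ x) (*-antiʳ-≤ x 0≤y)

  -- Minimality turns `a * y ≤ a` into `a * y ≈ a`, so `a ≤ x` times `y` still starts at `a`.
  B-*-closed : ∀ {a x y} → a ∈ I → x ∈ B a → 0# ≤ y → x * y ∈ B a
  B-*-closed {a} {y = y} a∈I a≤x 0≤y =
    ≤-respˡ-≈ (a∈I (a * y) (0≤y⇒x*y≤x a 0≤y)) (*-monoˡ-≤ y a≤x)

  -- Solidity with third element `x * y` exchanges the last two factors, leaving
  -- `(x * y) * (x * y)`.
  x*[x*y]≤y : Solid → ∀ {x y} → SameBranch x y → x * (x * y) ≤ y
  x*[x*y]≤y solid {x} {y} xy =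
    trans (sym (solid x y (x * y) xy)) (*-self (x * y))

  x*[x*y]≤y*[y*x] : Solid → BranchwiseImplicative →
                    ∀ {x y} → SameBranch x y → x * (x * y) ≤ y * (y * x)
  x*[x*y]≤y*[y*x] solid implicative {x} {y} xy@(a , a∈I , a≤x , a≤y) =
    ≤-trans u≤y*[y*u] (*-antiʳ-≤ y (*-antiʳ-≤ y u≤x))
    where
    u : Carrier
    u = x * (x * y)

    0≤x*y : 0# ≤ x * y
    0≤x*y = sameBranch⇒0≤x*y xy

    u≤x : u ≤ x
    u≤x = 0≤y⇒x*y≤x x 0≤x*y

    u≤y*[y*u] : u ≤ y * (y * u)
    u≤y*[y*u] =
      -- Implicativity applies to `u` and `y` because `u` stays in `B a`.
      ≤-respˡ-≈ (implicative u y (a , a∈I , B-*-closed a∈I a≤x 0≤x*y , a≤y))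
                (*-monoˡ-≤ (y * u) (x*[x*y]≤y solid xy))

theorem3p8 : (c ℓ : Level) (X : WeakBCCAlgebra c ℓ) →
    WeakBCCAlgebra.Solid X →
    WeakBCCAlgebra.BranchwiseImplicative X →
    WeakBCCAlgebra.BranchwiseCommutative X
theorem3p8 c ℓ X solid implicative x y xy =
  *-antisym (x*[x*y]≤y*[y*x] solid implicative xy)
            (x*[x*y]≤y*[y*x] solid implicative (sameBranch-sym xy))
  where
  open WeakBCCAlgebra X
  open WeakBCCProperties X
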